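{- $gr^3_2(B_5)=9$.
   Context: $K_n$ is the complete graph of order $n$. The book $B_n:=K_2+nK_1$ (graph join) is the graph on $n+2$ vertices consisting of an edge $xy$ (the spine) together with $n$ further, pairwise non-adjacent vertices (the pages), each adjacent to both $x$ and $y$. A $t$-coloring of $K_p$ is a map $f:E(K_p)\to\{1,\dots,t\}$, not assumed surjective. A Gallai $t$-coloring is a $t$-coloring with no rainbow triangle, i.e. there are no three vertices $x,y,z$ such that $f(xy),f(xz),f(yz)$ are pairwise distinct. For $1\le s<t$ and a graph $G$, the weakened Gallai-Ramsey number $gr^t_s(G)$ is the least $p\in\mathbb{N}$ such that every Gallai $t$-coloring of $K_p$ contains a (not necessarily induced) subgraph isomorphic to $G$ whose edges use at most $s$ colors. -}

module Defs where

open import Data.Empty using (⊥)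
open import Data.Fin using (Fin)
open import Data.Fin.Subset using (Subset; _∈_; ∣_∣)
open import Data.Nat using (ℕ; _≤_)
open import Data.Product using (_×_; Σ-syntax; ∃-syntax)
open import Data.Sum using (_⊎_; inj₁; inj₂)
open import Data.Unit using (⊤; tt)
open import Function.Definitions using (Injective)
open import Relation.Binary.PropositionalEquality using (_≡_; _≢_; refl; sym)
open import Relation.Nullary using (¬_)

record SimpleGraph : Set₁ where
  field
    Vertex : Set
    Adj    : Vertex → Vertex → Set
    Adj-sym    : ∀ {u v} → Adj u v → Adj v u
    Adj-irrefl : ∀ {v} → ¬ Adj v v

open SimpleGraph

complete : ℕ → SimpleGraph
complete n = record
  { Vertex     = Fin n
  ; Adj        = _≢_
  ; Adj-sym    = λ u≢v v≡u → u≢v (sym v≡u)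
  ; Adj-irrefl = λ v≢v → v≢v refl
  }

-- The disjoint union n K₁ of n one-vertex graphs.
edgeless : ℕ → SimpleGraph
edgeless n = record
  { Vertex     = Fin n
  ; Adj        = λ _ _ → ⊥
  ; Adj-sym    = λ ()
  ; Adj-irrefl = λ ()
  }

module _ (G H : SimpleGraph) where

  JoinAdj : Vertex G ⊎ Vertex H → Vertex G ⊎ Vertex H → Set
  JoinAdj (inj₁ u) (inj₁ v) = Adj G u v
  JoinAdj (inj₁ _) (inj₂ _) = ⊤
  JoinAdj (inj₂ _) (inj₁ _) = ⊤
  JoinAdj (inj₂ u) (inj₂ v) = Adj H u v

  JoinAdj-sym : ∀ u v → JoinAdj u v → JoinAdj v u
  JoinAdj-sym (inj₁ _) (inj₁ _) a = Adj-sym G a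
  JoinAdj-sym (inj₁ _) (inj₂ _) _ = tt
  JoinAdj-sym (inj₂ _) (inj₁ _) _ = tt
  JoinAdj-sym (inj₂ _) (inj₂ _) a = Adj-sym H a

  JoinAdj-irrefl : ∀ v → ¬ JoinAdj v v
  JoinAdj-irrefl (inj₁ _) = Adj-irrefl G
  JoinAdj-irrefl (inj₂ _) = Adj-irrefl H

  join : SimpleGraph
  join = record
    { Vertex     = Vertex G ⊎ Vertex H
    ; Adj        = JoinAdj
    ; Adj-sym    = λ {u} {v} → JoinAdj-sym u v
    ; Adj-irrefl = λ {v} → JoinAdj-irrefl v
    }

book : ℕ → SimpleGraph
book n = join (complete 2) (edgeless n)

-- A t-coloring of the edges of K_p, as a symmetric function of the two
-- endpoints.  Values on the diagonal carry no meaning: the notions below only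
-- look at the color of pairs of distinct vertices.
record Coloring (p t : ℕ) : Set where
  field
    color     : Fin p → Fin p → Fin t
    color-sym : ∀ u v → color u v ≡ color v u

open Coloring

RainbowTriangle : ∀ {p t} → Coloring p t → Set
RainbowTriangle f = ∃[ x ] ∃[ y ] ∃[ z ]
  (x ≢ y × x ≢ z × y ≢ z) ×
  (color f x y ≢ color f x z × color f x y ≢ color f y z × color f x z ≢ color f y z)

Gallai : ∀ {p t} → Coloring p t → Set
Gallai f = ¬ RainbowTriangle f

-- A (not necessarily induced) copy of G in K_p is an injection of its vertices,
-- since distinct vertices of K_p are always adjacent.  Its edges use at most s
-- colors when they all take colors in some set of at most s colors.
ContainsWithin : ∀ {p t} → ℕ → SimpleGraph → Coloring p t → Set
ContainsWithin {p} {t} s G f =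
  Σ[ φ ∈ (Vertex G → Fin p) ] Injective _≡_ _≡_ φ ×
  (Σ[ S ∈ Subset t ] ∣ S ∣ ≤ s × (∀ u v → Adj G u v → color f (φ u) (φ v) ∈ S))

GallaiRamseyProperty : (t s : ℕ) → SimpleGraph → ℕ → Set
GallaiRamseyProperty t s G p =
  (f : Coloring p t) → Gallai f → ContainsWithin s G f

IsLeast : (ℕ → Set) → ℕ → Set
IsLeast P p = P p × (∀ q → P q → p ≤ q)

-- gr^t_s(G) = p, for 1 ≤ s < t.  A relation rather than a function, so that the
-- existence of the least p is part of what is asserted.
gr[_,_]_≔_ : (t s : ℕ) → SimpleGraph → ℕ → Set
gr[ t , s ] G ≔ p = IsLeast (GallaiRamseyProperty t s G) p

{-# OPTIONS --safe #-}
module Submission where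

-- Upper bound.  If no edge xy is the spine of a two-coloured B₅, then for each
-- colour d other than that of xy at least three of the seven remaining vertices
-- are joined to x or y in colour d.  By the Gallai condition these two sets of
-- vertices are disjoint, so xy lies in at most one monochromatic triangle.
-- After sorting the vertices by their colours towards a monochromatic triangle
-- (towards one edge if there is no such triangle), a backtracking search over
-- the colours of K₉ finds no colouring satisfying these conditions.
--
-- Lower bound.  In a blow-up of the 2-coloured K₄ without monochromatic triangles,
-- with each vertex replaced by an edge of the third colour, every candidate
-- spine and every colour d absent from it leaves at most four pages avoiding d.

open import Defs

open import Data.Bool using (Bool; true; false; T; not; _∧_; _∨_)
open import Data.Bool.ListAction using (all; any)
open import Data.Bool.Properties using (T-∧; T-∨; T-≡; T?)
open import Data.Fin using (Fin; zero; suc; toℕ; cast; inject≤; punchIn; splitAt)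
open import Data.Fin.Patterns
open import Data.Fin.Permutation
  using (Permutation′; _⟨$⟩ʳ_; _⟨$⟩ˡ_; inverseˡ; inverseʳ; transpose)
open import Data.Fin.Properties
  using (_≟_; any?; all?; suc-injective; toℕ-cast; toℕ-injective; punchInᵢ≢i; injective⇒≤; inject≤-injective; +↔⊎)
open import Data.Fin.Subset using (Subset; _∈_; _∉_; _⊆_; ∣_∣; ⁅_⁆; ∁; _∪_; _∩_; ⊤; inside; outside)
open import Data.Fin.Subset.Properties
  using (p⊆q⇒∣p∣≤∣q∣; x∈p∪q⁺; x∈p∩q⁺; x∈⁅x⁆; ∣⁅x⁆∣≡1; ∣⊤∣≡n; ∣∁p∣≡n∸∣p∣; x∉p⇒x∈∁p; x≢y⇒x∉⁅y⁆)
open import Data.List as List using (List; []; _∷_; _++_; length; allFin)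
open import Data.List.Membership.Propositional using () renaming (_∈_ to _∈ˡ_)
open import Data.List.Membership.Propositional.Properties using (∈-∃++; ∈-++⁻; ∈-allFin; ∈-lookup)
open import Data.List.Properties using (length-tabulate)
open import Data.List.Relation.Binary.Permutation.Propositional
  using (_↭_; ↭-sym; ↭-trans; ↭-refl; ↭⇒↭ₛ)
open import Data.List.Relation.Binary.Permutation.Propositional.Properties
  using (∈-resp-↭; ↭-length; shift; ++⁺ˡ)
import Data.List.Relation.Binary.Permutation.Setoid.Properties as Permutationₛ
import Data.List.Sort
open import Data.List.Relation.Unary.All as All using (All; []; _∷_)
import Data.List.Relation.Unary.All.Properties as All
import Data.List.Relation.Unary.Any.Properties as Any
open import Data.List.Relation.Unary.AllPairs using ([]; _∷_)
open import Data.List.Relation.Unary.Sorted.TotalOrder.Properties using (lookup-mono-≤)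
open import Data.List.Relation.Unary.Unique.Propositional using (Unique)
open import Data.List.Relation.Unary.Unique.Propositional.Properties using (allFin⁺)
open import Data.Maybe using (Maybe; just; nothing)
open import Data.Maybe.Properties using (just-injective)
open import Data.Nat using (ℕ; zero; suc; _+_; _*_; _∸_; _/_; _≤_; _<_; _≤ᵇ_; _<ᵇ_; z≤n; s≤s; ∣_-_∣)
open import Data.Nat.Properties
  using (≤-refl; ≤-reflexive; ≤-trans; ≤-decTotalOrder; _≤?_; <⇒≱; ≰⇒>; <ᵇ⇒<; ≤ᵇ⇒≤; +-suc; m≤m+n;
         +-mono-≤; +-monoʳ-≤; +-cancelʳ-≤; ∣-∣-comm; module ≤-Reasoning)
open import Data.Product using (Σ-syntax; ∃-syntax; _×_; _,_; proj₁; proj₂)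
open import Data.Sum as Sum using (_⊎_; inj₁; inj₂; [_,_]; [_,_]′)
open import Data.Sum.Properties using (inj₂-injective)
open import Data.Unit using (tt)
open import Data.Vec as Vec using (Vec; []; _∷_; lookup; tabulate; zipWith; replicate; _[_]≔_; _[_]%=_)
open import Data.Vec.Properties
  using (lookup-zipWith; lookup∘tabulate; lookup-replicate; lookup∘update; lookup∘update′;
         lookup∘updateAt; lookup∘updateAt′; []=⇒lookup; lookup⇒[]=)
open import Function using (_∘_; Equivalence)
open import Function.Bundles using (Injection)
open import Function.Properties.Inverse using (↔⇒↣)
open import Function.Definitions using (Injective)
open import Relation.Binary.Bundles using (DecTotalOrder)
import Relation.Binary.Construct.On as On
open import Relation.Binary.PropositionalEquality
  using (_≡_; _≢_; refl; sym; trans; cong; cong₂; subst; setoid)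
open import Relation.Nullary using (¬_; Dec; yes; no; does; contradiction)
open import Relation.Nullary.Decidable using (¬?; _×-dec_; _⊎-dec_; _→-dec_; from-yes; from-no; toSum)

open Coloring

-- Booleans and finite subsets.

Colour : Set
Colour = Fin 3

private variable
  m n k t : ℕ

infix 4 _==_

_==_ : Fin n → Fin n → Bool
x == y = does (x ≟ y)

==⇒≡ : {x y : Fin n} → T (x == y) → x ≡ y
==⇒≡ {x = x} {y} h with x ≟ y
... | yes x≡y = x≡y

not==⇒≢ : {x y : Fin n} → T (not (x == y)) → x ≢ y
not==⇒≢ {x = x} {y} h with x ≟ y
... | no x≢y = x≢y

≢⇒not== : {x y : Fin n} → x ≢ y → T (not (x == y))
≢⇒not== {x = x} {y} x≢y with x ≟ y
... | yes x≡y = x≢y x≡y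
... | no _    = tt

∧⁻ : ∀ {a b} → T (a ∧ b) → T a × T b
∧⁻ = Equivalence.to T-∧

∧⁺ : ∀ {a b} → T a → T b → T (a ∧ b)
∧⁺ p q = Equivalence.from T-∧ (p , q)

∨⁻ : ∀ {a b} → T (a ∨ b) → T a ⊎ T b
∨⁻ = Equivalence.to T-∨

∈⇒T : {p : Subset n} {x : Fin n} → x ∈ p → T (lookup p x)
∈⇒T x∈p = Equivalence.from T-≡ ([]=⇒lookup x∈p)

T⇒∈ : {p : Subset n} {x : Fin n} → T (lookup p x) → x ∈ p
T⇒∈ {p = p} {x} h = lookup⇒[]= x p (Equivalence.to T-≡ h)

∈tabulate⁻ : {P : Fin n → Bool} {x : Fin n} → x ∈ tabulate P → T (P x)
∈tabulate⁻ {P = P} {x} x∈ = subst T (lookup∘tabulate P x) (∈⇒T x∈)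

∈tabulate⁺ : {P : Fin n → Bool} {x : Fin n} → T (P x) → x ∈ tabulate P
∈tabulate⁺ {P = P} {x} Px = T⇒∈ (subst T (sym (lookup∘tabulate P x)) Px)

∣p∣+∣q∣≡∣p∪q∣+∣p∩q∣ : (p q : Subset n) → ∣ p ∣ + ∣ q ∣ ≡ ∣ p ∪ q ∣ + ∣ p ∩ q ∣
∣p∣+∣q∣≡∣p∪q∣+∣p∩q∣ [] [] = refl
∣p∣+∣q∣≡∣p∪q∣+∣p∩q∣ (outside ∷ p) (outside ∷ q) = ∣p∣+∣q∣≡∣p∪q∣+∣p∩q∣ p q
∣p∣+∣q∣≡∣p∪q∣+∣p∩q∣ (inside ∷ p) (outside ∷ q) = cong suc (∣p∣+∣q∣≡∣p∪q∣+∣p∩q∣ p q)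
∣p∣+∣q∣≡∣p∪q∣+∣p∩q∣ (outside ∷ p) (inside ∷ q) =
  trans (+-suc ∣ p ∣ ∣ q ∣) (cong suc (∣p∣+∣q∣≡∣p∪q∣+∣p∩q∣ p q))
∣p∣+∣q∣≡∣p∪q∣+∣p∩q∣ (inside ∷ p) (inside ∷ q) = cong suc
  (trans (+-suc ∣ p ∣ ∣ q ∣)
    (trans (cong suc (∣p∣+∣q∣≡∣p∪q∣+∣p∩q∣ p q)) (sym (+-suc ∣ p ∪ q ∣ ∣ p ∩ q ∣))))

∣p∪q∣≤∣p∣+∣q∣ : (p q : Subset n) → ∣ p ∪ q ∣ ≤ ∣ p ∣ + ∣ q ∣
∣p∪q∣≤∣p∣+∣q∣ p q = ≤-trans (m≤m+n ∣ p ∪ q ∣ ∣ p ∩ q ∣) (≤-reflexive (sym (∣p∣+∣q∣≡∣p∪q∣+∣p∩q∣ p q)))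

-- Turns a count into actual vertices: the five pages of a book or, with `k = 1`, a single witness.
members : (p : Subset n) → k ≤ ∣ p ∣ →
  Σ[ φ ∈ (Fin k → Fin n) ] Injective _≡_ _≡_ φ × (∀ i → φ i ∈ p)
members {k = zero} p _ = (λ ()) , (λ { {()} }) , λ ()
members {k = suc k} (outside ∷ p) k≤ with φ , φ-inj , φ∈ ← members p k≤ =
  suc ∘ φ , φ-inj ∘ suc-injective , λ i → Vec.there (φ∈ i)
members {k = suc k} (inside ∷ p) (s≤s k≤) with φ , φ-inj , φ∈ ← members p k≤ =
  ψ , ψ-inj , ψ∈
  where
  ψ : Fin (suc k) → Fin _
  ψ zero    = zero
  ψ (suc i) = suc (φ i)
  ψ-inj : Injective _≡_ _≡_ ψ
  ψ-inj {zero}  {zero}  _  = refl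
  ψ-inj {suc i} {suc j} eq = cong suc (φ-inj (suc-injective eq))
  ψ∈ : ∀ i → ψ i ∈ inside ∷ p
  ψ∈ zero    = Vec.here
  ψ∈ (suc i) = Vec.there (φ∈ i)

-- Renaming vertices and permuting colours.

reindex : (Fin m → Fin n) → Coloring n t → Coloring m t
reindex σ f = record
  { color     = λ x y → color f (σ x) (σ y)
  ; color-sym = λ x y → color-sym f (σ x) (σ y)
  }

recolour : Permutation′ t → Coloring n t → Coloring n t
recolour π f = record
  { color     = λ x y → π ⟨$⟩ʳ color f x y
  ; color-sym = λ x y → cong (π ⟨$⟩ʳ_) (color-sym f x y)
  }

perm-injective : (π : Permutation′ t) → Injective _≡_ _≡_ (π ⟨$⟩ʳ_)
perm-injective π eq = trans (sym (inverseˡ π)) (trans (cong (π ⟨$⟩ˡ_) eq) (inverseˡ π))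

reindex-gallai : {σ : Fin m → Fin n} (f : Coloring n t) → Injective _≡_ _≡_ σ →
  Gallai f → Gallai (reindex σ f)
reindex-gallai {σ = σ} f σ-inj gallai (x , y , z , (x≢y , x≢z , y≢z) , rainbow) =
  gallai (σ x , σ y , σ z , (x≢y ∘ σ-inj , x≢z ∘ σ-inj , y≢z ∘ σ-inj) , rainbow)

recolour-gallai : (π : Permutation′ t) (f : Coloring n t) → Gallai f → Gallai (recolour π f)
recolour-gallai π f gallai (x , y , z , distinct , (xy≢xz , xy≢yz , xz≢yz)) =
  gallai (x , y , z , distinct ,
    (xy≢xz ∘ cong (π ⟨$⟩ʳ_) , xy≢yz ∘ cong (π ⟨$⟩ʳ_) , xz≢yz ∘ cong (π ⟨$⟩ʳ_)))

reindex-contains : {σ : Fin m → Fin n} (f : Coloring n t) (s : ℕ) (G : SimpleGraph) → Injective _≡_ _≡_ σ →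
  ContainsWithin s G (reindex σ f) → ContainsWithin s G f
reindex-contains {σ = σ} f s G σ-inj (φ , φ-inj , within) = σ ∘ φ , φ-inj ∘ σ-inj , within

-- Conditions on an edge and its third vertices.

-- The endpoints are excluded by hand because diagonal colours are arbitrary.
common : Coloring n 3 → (Colour → Colour → Bool) → Fin n → Fin n → Subset n
common f P x y = tabulate λ z → not (x == z) ∧ not (y == z) ∧ P (color f x z) (color f y z)

∈common⁻ : (f : Coloring n 3) (P : Colour → Colour → Bool) (x y : Fin n) {z : Fin n} → z ∈ common f P x y →
  x ≢ z × y ≢ z × T (P (color f x z) (color f y z))
∈common⁻ f P x y z∈ with x≢z , h ← ∧⁻ (∈tabulate⁻ z∈) with y≢z , Pz ← ∧⁻ h =
  not==⇒≢ x≢z , not==⇒≢ y≢z , Pz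

∈common⁺ : (f : Coloring n 3) (P : Colour → Colour → Bool) (x y : Fin n) {z : Fin n} →
  x ≢ z → y ≢ z → T (P (color f x z) (color f y z)) → z ∈ common f P x y
∈common⁺ f P x y x≢z y≢z Pz = ∈tabulate⁺ (∧⁺ (≢⇒not== x≢z) (∧⁺ (≢⇒not== y≢z) Pz))

avoids : Colour → Colour → Colour → Bool
avoids d a b = not (a == d) ∧ not (b == d)

rainbow : Colour → Colour → Colour → Bool
rainbow c a b = not (c == a) ∧ not (c == b) ∧ not (a == b)

mono : Colour → Colour → Colour → Bool
mono c a b = (c == a) ∧ (c == b)

-- The rule (k , P) for an edge xy asks for fewer than k vertices z such that
-- P holds of the colours of xz and yz.
Rule : Set
Rule = ℕ × (Colour → Colour → Bool)

Obeys : Coloring n 3 → Fin n → Fin n → Rule → Set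
Obeys f x y (k , P) = ∣ common f P x y ∣ < k

Lawful : (Colour → List Rule) → Coloring n 3 → Set
Lawful rules f = ∀ {x y} → x ≢ y → All (Obeys f x y) (rules (color f x y))

rainbowRule : Colour → Rule
rainbowRule c = 1 , rainbow c

monoRule : ℕ → Colour → Rule
monoRule k c = k , mono c

-- `punchIn c` enumerates the two colours other than `c`, the candidates for the colour that a
-- two-coloured book with spine of colour `c` omits.
bookRules : Colour → List Rule
bookRules c = (5 , avoids (punchIn c 0F)) ∷ (5 , avoids (punchIn c 1F)) ∷ []

-- Using at most two of the three colours means avoiding one of them, d.
Book : Coloring n 3 → Set
Book f = ∃[ x ] ∃[ y ] ∃[ d ] x ≢ y × color f x y ≢ d × 5 ≤ ∣ common f (avoids d) x y ∣

book? : (f : Coloring n 3) → Dec (Book f)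
book? f = any? λ x → any? λ y → any? λ d →
  ¬? (x ≟ y) ×-dec ¬? (color f x y ≟ d) ×-dec 5 ≤? ∣ common f (avoids d) x y ∣

book⇒contains : (f : Coloring n 3) → Book f → ContainsWithin 2 (book 5) f
book⇒contains f (x , y , d , x≢y , xy≢d , five)
  with φ , φ-inj , φ∈ ← members (common f (avoids d) x y) five =
  ψ , (λ {u} {v} → ψ-inj u v) , ∁ ⁅ d ⁆ , ≤-reflexive ∣∁d∣≡2 , within
  where
  page : ∀ i → x ≢ φ i × y ≢ φ i × color f x (φ i) ≢ d × color f y (φ i) ≢ d
  page i with x≢ , y≢ , h ← ∈common⁻ f (avoids d) x y (φ∈ i) with xd , yd ← ∧⁻ h =
    x≢ , y≢ , not==⇒≢ xd , not==⇒≢ yd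
  ψ : Fin 2 ⊎ Fin 5 → Fin _
  ψ (inj₁ 0F) = x
  ψ (inj₁ 1F) = y
  ψ (inj₂ i)  = φ i
  ψ-inj : ∀ u v → ψ u ≡ ψ v → u ≡ v
  ψ-inj (inj₁ 0F) (inj₁ 0F) _  = refl
  ψ-inj (inj₁ 0F) (inj₁ 1F) eq = contradiction eq x≢y
  ψ-inj (inj₁ 1F) (inj₁ 0F) eq = contradiction (sym eq) x≢y
  ψ-inj (inj₁ 1F) (inj₁ 1F) _  = refl
  ψ-inj (inj₁ 0F) (inj₂ i)  eq = contradiction eq (proj₁ (page i))
  ψ-inj (inj₁ 1F) (inj₂ i)  eq = contradiction eq (proj₁ (proj₂ (page i)))
  ψ-inj (inj₂ i)  (inj₁ 0F) eq = contradiction (sym eq) (proj₁ (page i))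
  ψ-inj (inj₂ i)  (inj₁ 1F) eq = contradiction (sym eq) (proj₁ (proj₂ (page i)))
  ψ-inj (inj₂ i)  (inj₂ j)  eq = cong inj₂ (φ-inj eq)
  ∣∁d∣≡2 : ∣ ∁ ⁅ d ⁆ ∣ ≡ 2
  ∣∁d∣≡2 = trans (∣∁p∣≡n∸∣p∣ ⁅ d ⁆) (cong (3 ∸_) (∣⁅x⁆∣≡1 d))
  ∈∁ : ∀ {c} → c ≢ d → c ∈ ∁ ⁅ d ⁆
  ∈∁ c≢d = x∉p⇒x∈∁p (x≢y⇒x∉⁅y⁆ c≢d)
  within : ∀ u v → SimpleGraph.Adj (book 5) u v → color f (ψ u) (ψ v) ∈ ∁ ⁅ d ⁆
  within (inj₁ 0F) (inj₁ 0F) 0≢0 = contradiction refl 0≢0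
  within (inj₁ 0F) (inj₁ 1F) _ = ∈∁ xy≢d
  within (inj₁ 1F) (inj₁ 0F) _ = ∈∁ (xy≢d ∘ trans (color-sym f x y))
  within (inj₁ 1F) (inj₁ 1F) 1≢1 = contradiction refl 1≢1
  within (inj₁ 0F) (inj₂ i) _ = ∈∁ (proj₁ (proj₂ (proj₂ (page i))))
  within (inj₁ 1F) (inj₂ i) _ = ∈∁ (proj₂ (proj₂ (proj₂ (page i))))
  within (inj₂ i) (inj₁ 0F) _ = ∈∁ (proj₁ (proj₂ (proj₂ (page i))) ∘ trans (color-sym f x (φ i)))
  within (inj₂ i) (inj₁ 1F) _ = ∈∁ (proj₂ (proj₂ (proj₂ (page i))) ∘ trans (color-sym f y (φ i)))

recolour-book : (π : Permutation′ 3) (f : Coloring n 3) → Book (recolour π f) → Book f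
recolour-book π f (x , y , d , x≢y , xy≢d , five) =
  x , y , π ⟨$⟩ˡ d , x≢y , pull xy≢d , ≤-trans five (p⊆q⇒∣p∣≤∣q∣ pages⊆)
  where
  pull : ∀ {c} → π ⟨$⟩ʳ c ≢ d → c ≢ π ⟨$⟩ˡ d
  pull πc≢d c≡ = πc≢d (trans (cong (π ⟨$⟩ʳ_) c≡) (inverseʳ π))
  pages⊆ : common (recolour π f) (avoids d) x y ⊆ common f (avoids (π ⟨$⟩ˡ d)) x y
  pages⊆ z∈ with x≢z , y≢z , h ← ∈common⁻ (recolour π f) (avoids d) x y z∈ with a , b ← ∧⁻ h =
    ∈common⁺ f (avoids (π ⟨$⟩ˡ d)) x y x≢z y≢z
      (∧⁺ (≢⇒not== (pull (not==⇒≢ a))) (≢⇒not== (pull (not==⇒≢ b))))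

-- Rules obeyed by a Gallai colouring without the book.

bookRules-lawful : (f : Coloring n 3) → ¬ Book f → Lawful bookRules f
bookRules-lawful f no-book {x} {y} x≢y = few 0F ∷ few 1F ∷ []
  where
  few : ∀ i → ∣ common f (avoids (punchIn (color f x y) i)) x y ∣ < 5
  few i = ≰⇒> λ five → no-book
    (x , y , punchIn (color f x y) i , x≢y , punchInᵢ≢i (color f x y) i ∘ sym , five)

none : (f : Coloring n 3) (P : Colour → Colour → Bool) {x y : Fin n} →
  (∀ {z} → x ≢ z → y ≢ z → ¬ T (P (color f x z) (color f y z))) → ∣ common f P x y ∣ < 1
none f P {x} {y} ¬P = ≰⇒> λ some → let φ , _ , φ∈ = members (common f P x y) some
                                       x≢ , y≢ , Pz = ∈common⁻ f P x y (φ∈ 0F)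
                                   in ¬P x≢ y≢ Pz

rainbow-free : (f : Coloring n 3) → Gallai f → ∀ {x y z} → x ≢ y → x ≢ z → y ≢ z →
  ¬ T (rainbow (color f x y) (color f x z) (color f y z))
rainbow-free f gallai {x} {y} {z} x≢y x≢z y≢z h with xy≢xz , h′ ← ∧⁻ h with xy≢yz , xz≢yz ← ∧⁻ h′ =
  gallai (x , y , z , (x≢y , x≢z , y≢z) , (not==⇒≢ xy≢xz , not==⇒≢ xy≢yz , not==⇒≢ xz≢yz))

rainbowRule-lawful : (f : Coloring n 3) → Gallai f →
  ∀ {x y} → x ≢ y → Obeys f x y (rainbowRule (color f x y))
rainbowRule-lawful f gallai {x} {y} x≢y =
  none f (rainbow (color f x y)) (rainbow-free f gallai x≢y)

-- If both colours other than `c` occurred on the two edges, each would occur once and the triangle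
-- would be rainbow.
one-avoided : ∀ c a b → ¬ T (rainbow c a b) →
  T (avoids (punchIn c 0F) a b) ⊎ T (avoids (punchIn c 1F) a b)
one-avoided = from-yes (all? λ c → all? λ a → all? λ b →
  ¬? (T? (rainbow c a b)) →-dec (T? (avoids (punchIn c 0F) a b) ⊎-dec T? (avoids (punchIn c 1F) a b)))

mono⇒both-avoided : ∀ c a b → T (mono c a b) →
  T (avoids (punchIn c 0F) a b) × T (avoids (punchIn c 1F) a b)
mono⇒both-avoided = from-yes (all? λ c → all? λ a → all? λ b →
  T? (mono c a b) →-dec (T? (avoids (punchIn c 0F) a b) ×-dec T? (avoids (punchIn c 1F) a b)))

-- Each of the seven other vertices avoids one of the two colours d, e missing
-- on the edge xy, and a monochromatic triangle avoids both.  With two such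
-- triangles, d or e is avoided at least (7 + 2) / 2 times.
monoRule₂-lawful : (f : Coloring 9 3) → Gallai f → ¬ Book f →
  ∀ {x y} → x ≢ y → Obeys f x y (monoRule 2 (color f x y))
monoRule₂-lawful f gallai no-book {x} {y} x≢y with bookRules-lawful f no-book x≢y
... | s≤s A≤4 ∷ s≤s B≤4 ∷ [] = ≰⇒> λ C≥2 → <⇒≱ {8} {9} ≤-refl (begin
    9                         ≤⟨ +-mono-≤ A∪B≥7 (≤-trans C≥2 (p⊆q⇒∣p∣≤∣q∣ C⊆A∩B)) ⟩
    ∣ A ∪ B ∣ + ∣ A ∩ B ∣     ≡⟨ ∣p∣+∣q∣≡∣p∪q∣+∣p∩q∣ A B ⟨
    ∣ A ∣ + ∣ B ∣             ≤⟨ +-mono-≤ A≤4 B≤4 ⟩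
    8                         ∎)
  where
  open ≤-Reasoning
  c = color f x y
  A = common f (avoids (punchIn c 0F)) x y
  B = common f (avoids (punchIn c 1F)) x y
  C⊆A∩B : common f (mono c) x y ⊆ A ∩ B
  C⊆A∩B {z} z∈ with x≢z , y≢z , h ← ∈common⁻ f (mono c) x y z∈ with d , e ← mono⇒both-avoided c _ _ h =
    x∈p∩q⁺ (∈common⁺ f (avoids (punchIn c 0F)) x y x≢z y≢z d , ∈common⁺ f (avoids (punchIn c 1F)) x y x≢z y≢z e)
  covered : ⊤ ⊆ (A ∪ B) ∪ (⁅ x ⁆ ∪ ⁅ y ⁆)
  covered {z} _ with x ≟ z
  ... | yes refl = x∈p∪q⁺ (inj₂ (x∈p∪q⁺ (inj₁ (x∈⁅x⁆ x))))
  ... | no x≢z with y ≟ z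
  ...   | yes refl = x∈p∪q⁺ (inj₂ (x∈p∪q⁺ (inj₂ (x∈⁅x⁆ y))))
  ...   | no y≢z with one-avoided c _ _ (rainbow-free f gallai x≢y x≢z y≢z)
  ...     | inj₁ d = x∈p∪q⁺ (inj₁ (x∈p∪q⁺ (inj₁ (∈common⁺ f (avoids (punchIn c 0F)) x y x≢z y≢z d))))
  ...     | inj₂ e = x∈p∪q⁺ (inj₁ (x∈p∪q⁺ {p = A} (inj₂ (∈common⁺ f (avoids (punchIn c 1F)) x y x≢z y≢z e))))
  A∪B≥7 : 7 ≤ ∣ A ∪ B ∣
  A∪B≥7 = +-cancelʳ-≤ 2 7 ∣ A ∪ B ∣ (begin
    9                                   ≡⟨ ∣⊤∣≡n 9 ⟨
    ∣ ⊤ {9} ∣                           ≤⟨ p⊆q⇒∣p∣≤∣q∣ covered ⟩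
    ∣ (A ∪ B) ∪ (⁅ x ⁆ ∪ ⁅ y ⁆) ∣       ≤⟨ ∣p∪q∣≤∣p∣+∣q∣ (A ∪ B) (⁅ x ⁆ ∪ ⁅ y ⁆) ⟩
    ∣ A ∪ B ∣ + ∣ ⁅ x ⁆ ∪ ⁅ y ⁆ ∣       ≤⟨ +-monoʳ-≤ ∣ A ∪ B ∣ (∣p∪q∣≤∣p∣+∣q∣ ⁅ x ⁆ ⁅ y ⁆) ⟩
    ∣ A ∪ B ∣ + (∣ ⁅ x ⁆ ∣ + ∣ ⁅ y ⁆ ∣) ≡⟨ cong (∣ A ∪ B ∣ +_) (cong₂ _+_ (∣⁅x⁆∣≡1 x) (∣⁅x⁆∣≡1 y)) ⟩
    ∣ A ∪ B ∣ + 2                       ∎)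

-- Partial colourings.

Row : ℕ → Set
Row n = Vec (Maybe Colour) n

Table : ℕ → Set
Table n = Vec (Row n) n

row : Table n → Fin n → Row n
row = lookup

cell : Table n → Fin n → Fin n → Maybe Colour
cell t x y = lookup (row t x) y

empty : Table n
empty = replicate _ (replicate _ nothing)

set₁ : Fin n → Fin n → Colour → Table n → Table n
set₁ x y c t = t [ x ]%= (_[ y ]≔ just c)

-- Both orientations are written, so that a row holds all known colours at its vertex.
set : Fin n → Fin n → Colour → Table n → Table n
set x y c t = set₁ y x c (set₁ x y c t)

-- Requiring `x ≢ y` keeps the diagonal unfilled; hence `breaks` can compare two rows without
-- excluding the endpoints.
record Agrees (f : Coloring n 3) (t : Table n) : Set where
  field
    agree : ∀ x y {c} → cell t x y ≡ just c → x ≢ y × color f x y ≡ c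

open Agrees

empty-agrees : (f : Coloring n 3) → Agrees f empty
agree (empty-agrees {n} f) x y eq
  with () ← trans (sym (trans (cong (λ r → lookup r y) (lookup-replicate x (replicate n nothing)))
                              (lookup-replicate y nothing))) eq

set₁-agrees : (f : Coloring n 3) {t : Table n} {x y : Fin n} {c : Colour} → Agrees f t →
  x ≢ y → color f x y ≡ c → Agrees f (set₁ x y c t)
agree (set₁-agrees f {t} {x} {y} {c} ag x≢y xy≡c) u v eq with u ≟ x
... | no u≢x = agree ag u v (trans (sym (cong (λ r → lookup r v) (lookup∘updateAt′ u x u≢x t))) eq)
... | yes refl with v ≟ y
...   | no v≢y = agree ag x v
          (trans (sym (trans (cong (λ r → lookup r v) (lookup∘updateAt x t)) (lookup∘update′ v≢y (row t x) (just c)))) eq)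
...   | yes refl = x≢y , trans xy≡c (just-injective
          (trans (sym (trans (cong (λ r → lookup r v) (lookup∘updateAt x t)) (lookup∘update y (row t x) (just c)))) eq))

set-agrees : (f : Coloring n 3) {t : Table n} (x y : Fin n) {c : Colour} → Agrees f t →
  x ≢ y → color f x y ≡ c → Agrees f (set x y c t)
set-agrees f x y ag x≢y xy≡c =
  set₁-agrees f (set₁-agrees f ag x≢y xy≡c) (x≢y ∘ sym) (trans (color-sym f y x) xy≡c)

atLeast : ℕ → Subset n → Bool
atLeast zero    _             = true
atLeast (suc k) []            = false
atLeast (suc k) (inside  ∷ p) = atLeast k p
atLeast (suc k) (outside ∷ p) = atLeast (suc k) p

atLeast⇒≤ : ∀ k (p : Subset n) → T (atLeast k p) → k ≤ ∣ p ∣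
atLeast⇒≤ zero    p             _ = z≤n
atLeast⇒≤ (suc k) (inside  ∷ p) h = s≤s (atLeast⇒≤ k p h)
atLeast⇒≤ (suc k) (outside ∷ p) h = atLeast⇒≤ (suc k) p h

both : (Colour → Colour → Bool) → Maybe Colour → Maybe Colour → Bool
both P (just a) (just b) = P a b
both P _        _        = false

breaks : Row n → Row n → Rule → Bool
breaks u v (k , P) = atLeast k (zipWith (both P) u v)

-- Unknown cells are never counted, so the count in a table is a lower bound for the count in every
-- colouring that agrees with it.
breaks-sound : (f : Coloring n 3) {t : Table n} {x y : Fin n} (r : Rule) → Agrees f t →
  T (breaks (row t x) (row t y) r) → ¬ Obeys f x y r
breaks-sound f {t} {x} {y} (k , P) ag h few = <⇒≱ few (≤-trans (atLeast⇒≤ k found h) (p⊆q⇒∣p∣≤∣q∣ found⊆))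
  where
  found = zipWith (both P) (row t x) (row t y)
  known : ∀ z → T (both P (cell t x z) (cell t y z)) → z ∈ common f P x y
  known z h with cell t x z in eq₁ | cell t y z in eq₂
  ... | just a | just b with x≢z , refl ← agree ag x z eq₁ | y≢z , refl ← agree ag y z eq₂ = ∈common⁺ f P x y x≢z y≢z h
  found⊆ : found ⊆ common f P x y
  found⊆ {z} z∈ = known z (subst T (lookup-zipWith (both P) z (row t x) (row t y)) (∈⇒T {p = found} z∈))

breaksAny : (Colour → List Rule) → Row n → Maybe Colour → Row n → Bool
breaksAny rules u nothing  v = false
breaksAny rules u (just c) v = any (breaks u v) (rules c)

breaksAny-sound : ∀ rules (f : Coloring n 3) {t : Table n} {x y : Fin n} → Lawful rules f → Agrees f t →
  ¬ T (breaksAny rules (row t x) (cell t x y) (row t y))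
breaksAny-sound rules f {t} {x} {y} lawful ag h with cell t x y in eq
... | just c with x≢y , refl ← agree ag x y eq =
  let obeys , broken = All.lookupAny (lawful x≢y) (Any.any⁻ (breaks (row t x) (row t y)) (rules c) h)
  in breaks-sound f _ ag broken obeys

-- The backtracking search.

data Step (n : ℕ) : Set where
  colour    : Fin n → Fin n → Step n
  ascending : Fin n → Fin n → Step n

-- The colours towards the heads, read as base-3 digits with the first head least significant.
-- Comparing keys is thus lexicographic, starting from the last head.
key : Coloring n 3 → List (Fin n) → Fin n → ℕ
key f []       z = 0
key f (h ∷ hs) z = toℕ (color f h z) + 3 * key f hs z

key? : Table n → List (Fin n) → Fin n → Maybe ℕ
key? t []       z = just 0
key? t (h ∷ hs) z with cell t h z | key? t hs z
... | just c | just k = just (toℕ c + 3 * k)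
... | _      | _      = nothing

key?-sound : (f : Coloring n 3) {t : Table n} → Agrees f t → ∀ hs z → key? t hs z ≡ just k → key f hs z ≡ k
key?-sound f ag [] z refl = refl
key?-sound f {t} ag (h ∷ hs) z eq with cell t h z in eq₁ | key? t hs z in eq₂
key?-sound f {t} ag (h ∷ hs) z refl | just c | just k =
  cong₂ (λ c k → toℕ c + 3 * k) (proj₂ (agree ag h z eq₁)) (key?-sound f ag hs z eq₂)

below : Maybe ℕ → Maybe ℕ → Bool
below (just j) (just k) = j <ᵇ k
below _        _        = false

below-sound : (f : Coloring n 3) {t : Table n} → Agrees f t → ∀ hs w z →
  T (below (key? t hs w) (key? t hs z)) → key f hs w < key f hs z
below-sound f {t} ag hs w z h with key? t hs w in eqw | key? t hs z in eqz
... | just j | just k with refl ← key?-sound f ag hs w eqw | refl ← key?-sound f ag hs z eqz = <ᵇ⇒< _ _ h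

-- The local rules are tested only at the edge just coloured, the global ones at
-- all edges meeting it; this affects the running time, not the soundness.
module Search (local global : Colour → List Rule) (heads : List (Fin n)) where

  Ordered : Coloring n 3 → Set
  Ordered f = ∀ {z w} → length heads ≤ toℕ z → toℕ z ≤ toℕ w → key f heads z ≤ key f heads w

  conflict : Fin n → Fin n → Table n → Bool
  conflict x y t = breaksAny local (row t x) (cell t x y) (row t y) ∨ around x ∨ around y
    where
    around : Fin n → Bool
    around u = atLeast 1 (zipWith (breaksAny global (row t u)) (row t u) t)

  descends : Fin n → Fin n → Table n → Bool
  descends z w t =
    (length heads ≤ᵇ toℕ z) ∧ (toℕ z ≤ᵇ toℕ w) ∧ below (key? t heads w) (key? t heads z)

  refutes : List (Step n) → Table n → Bool
  tries   : Fin n → Fin n → List (Step n) → Table n → Bool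

  refutes []                   t = false
  -- The test `not (x == y)` lets soundness hold for every list of steps: a step on the diagonal
  -- refutes nothing.
  refutes (colour x y ∷ ss)    t = not (x == y) ∧ all (λ c → tries x y ss (set x y c t)) (allFin 3)
  refutes (ascending z w ∷ ss) t = descends z w t ∨ refutes ss t

  tries x y ss t = conflict x y t ∨ refutes ss t

  -- A record, so that checking one statement of it against another does not run
  -- the search; an equation, because T (refutes ss t) evaluates far more slowly.
  record Refuted (ss : List (Step n)) (t : Table n) : Set where
    constructor refuted
    field runs : refutes ss t ≡ true

  module _ (f : Coloring n 3) (lawfulˡ : Lawful local f) (lawfulᵍ : Lawful global f) (ordered : Ordered f) where

    conflict-sound : ∀ {x y t} → Agrees f t → ¬ T (conflict x y t)
    conflict-sound {x} {y} {t} ag h with ∨⁻ h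
    ... | inj₁ l = breaksAny-sound local f lawfulˡ ag l
    ... | inj₂ g = [ around x , around y ] (∨⁻ g)
      where
      around : ∀ u → ¬ T (atLeast 1 (zipWith (breaksAny global (row t u)) (row t u) t))
      around u h with φ , _ , φ∈ ← members _ (atLeast⇒≤ 1 (zipWith (breaksAny global (row t u)) (row t u) t) h) =
        breaksAny-sound global f lawfulᵍ ag
          (subst T (lookup-zipWith (breaksAny global (row t u)) (φ 0F) (row t u) t)
            (∈⇒T {p = zipWith (breaksAny global (row t u)) (row t u) t} (φ∈ 0F)))

    descends-sound : ∀ {z w t} → Agrees f t → ¬ T (descends z w t)
    descends-sound {z} {w} {t} ag h =
      let b≤z , h′ = ∧⁻ {length heads ≤ᵇ toℕ z} h
          z≤w , lt = ∧⁻ {toℕ z ≤ᵇ toℕ w} h′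
      in <⇒≱ (below-sound f ag heads w z lt) (ordered (≤ᵇ⇒≤ _ _ b≤z) (≤ᵇ⇒≤ _ _ z≤w))

    -- Follow the branch in which every edge receives its colour under `f`: its tables agree with
    -- `f`, so no conflict or descent is found in them, and running out of steps refutes nothing.
    refutes-sound : ∀ ss {t} → Agrees f t → ¬ T (refutes ss t)
    refutes-sound (colour x y ∷ ss) {t} ag h
      with x≢y , every ← ∧⁻ {not (x == y)} h
      with ag′ ← set-agrees f {t} x y ag (not==⇒≢ x≢y) refl
      with tried ← All.lookup (All.all⁺ (λ c → tries x y ss (set x y c t)) (allFin 3) every) (∈-allFin (color f x y))
      with ∨⁻ {conflict x y (set x y (color f x y) t)} tried
    ... | inj₁ now   = conflict-sound {x} {y} {set x y (color f x y) t} ag′ now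
    ... | inj₂ later = refutes-sound ss {set x y (color f x y) t} ag′ later
    refutes-sound (ascending z w ∷ ss) {t} ag h with ∨⁻ {descends z w t} h
    ... | inj₁ now   = descends-sound {z} {w} {t} ag now
    ... | inj₂ later = refutes-sound ss {t} ag later

    Refuted-sound : ∀ {ss t} → Agrees f t → ¬ Refuted ss t
    Refuted-sound {ss} ag (refuted runs) = refutes-sound ss ag (Equivalence.from T-≡ runs)

-- The two searches on nine vertices.

-- A new vertex `w` is coloured towards the heads `hs` first. This completes its key, so the order
-- prunes before any edge to the earlier vertices `ps` is tried.
schedule : List (Fin n) → List (Fin n) → List (Fin n) → List (Step n)
schedule hs ps []       = []
schedule hs ps (w ∷ ws) =
  List.map (λ h → colour h w) hs ++ List.map (λ p → ascending p w) ps ++ List.map (λ p → colour p w) ps ++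
  schedule hs (ps List.∷ʳ w) ws

steps : ℕ → List (Step 9)
steps b = schedule (List.take b (allFin 9)) [] (List.drop b (allFin 9))

-- A rainbow triangle shows at its last coloured edge, so its rule can be local. The other rules
-- count third vertices, and colouring an edge can raise the counts at adjacent edges coloured
-- before. The heads are reversed to make `0F` the leading digit of the key.
module WithTriangle = Search {9}
  (λ c → rainbowRule c ∷ []) (λ c → monoRule 2 c ∷ bookRules c) (2F ∷ 1F ∷ 0F ∷ [])

-- Here monochromatic triangles are forbidden outright; like rainbow ones they show at their last
-- edge, so their rule becomes local.
module WithoutTriangle = Search {9}
  (λ c → rainbowRule c ∷ monoRule 1 c ∷ []) bookRules (1F ∷ 0F ∷ [])

edgeTable triangleTable : Table 9
edgeTable     = set 0F 1F 0F empty
triangleTable = set 0F 2F 0F (set 1F 2F 0F edgeTable)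

triangle-refuted : WithTriangle.Refuted (steps 3) triangleTable
triangle-refuted = WithTriangle.refuted refl

edge-refuted : WithoutTriangle.Refuted (steps 2) edgeTable
edge-refuted = WithoutTriangle.refuted refl

-- Renumbering the vertices.

lookup-injective : ∀ {A : Set} {xs : List A} → Unique xs → Injective _≡_ _≡_ (List.lookup xs)
lookup-injective (x∉ ∷ u) {zero}  {zero}  _  = refl
lookup-injective (x∉ ∷ u) {zero}  {suc j} eq = contradiction eq (All.lookup x∉ (∈-lookup j))
lookup-injective (x∉ ∷ u) {suc i} {zero}  eq = contradiction (sym eq) (All.lookup x∉ (∈-lookup i))
lookup-injective (x∉ ∷ u) {suc i} {suc j} eq = cong suc (lookup-injective u eq)

bring-to-front : ∀ {A : Set} {hs xs : List A} → Unique hs → All (_∈ˡ xs) hs → ∃[ ws ] xs ↭ hs ++ ws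
bring-to-front {xs = xs} [] [] = xs , ↭-refl
bring-to-front {hs = h ∷ hs} (h∉hs ∷ u) (h∈xs ∷ hs⊆xs)
  with ws , xs↭ ← bring-to-front u hs⊆xs
  with ∈-++⁻ hs (∈-resp-↭ xs↭ h∈xs)
... | inj₁ h∈hs = contradiction refl (All.lookup h∉hs h∈hs)
... | inj₂ h∈ws with as , bs , refl ← ∈-∃++ h∈ws =
  as ++ bs , ↭-trans xs↭ (↭-trans (++⁺ˡ hs (shift h as bs)) (shift h hs (as ++ bs)))

-- The renumbering that the search presupposes: prescribed heads first, the remaining vertices in
-- nondecreasing order of `κ`.
record Arrangement (κ : Fin n → ℕ) (hs : List (Fin n)) : Set where
  field
    rest      : List (Fin n)
    size      : n ≡ length (hs ++ rest)
    unique    : Unique (hs ++ rest)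
    sorted    : ∀ {i j} → toℕ i ≤ toℕ j → κ (List.lookup rest i) ≤ κ (List.lookup rest j)

  vertex : Fin n → Fin n
  vertex i = List.lookup (hs ++ rest) (cast size i)

  vertex-injective : Injective _≡_ _≡_ vertex
  vertex-injective {i} {j} eq = toℕ-injective (trans (sym (toℕ-cast size i))
    (trans (cong toℕ (lookup-injective unique eq)) (toℕ-cast size j)))

  -- The general `m` and irrelevant `e` match what `cast size` reduces to once an index has been
  -- stripped of the heads.
  cast-sorted : ∀ {m} .(e : m ≡ length rest) {i j : Fin m} → toℕ i ≤ toℕ j →
    κ (List.lookup rest (cast e i)) ≤ κ (List.lookup rest (cast e j))
  cast-sorted e {i} {j} i≤j rewrite sym (toℕ-cast e i) | sym (toℕ-cast e j) = sorted i≤j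

arrange : (κ : Fin n → ℕ) {hs : List (Fin n)} → Unique hs → Arrangement κ hs
arrange {n} κ {hs} u with ws , all↭ ← bring-to-front u (All.tabulate λ {x} _ → ∈-allFin x) = record
  { rest      = sort ws
  ; size      = trans (sym (length-tabulate {n = n} (λ i → i))) (↭-length all↭′)
  ; unique    = Permutationₛ.Unique-resp-↭ (setoid (Fin n)) (↭⇒↭ₛ all↭′) (allFin⁺ n)
  ; sorted    = lookup-mono-≤ order (sort-↗ ws)
  }
  where
  order = DecTotalOrder.totalOrder (On.decTotalOrder ≤-decTotalOrder κ)
  open Data.List.Sort (On.decTotalOrder ≤-decTotalOrder κ) using (sort; sort-↭; sort-↗)
  all↭′ : allFin n ↭ hs ++ sort ws
  all↭′ = ↭-trans all↭ (++⁺ˡ hs (↭-sym (sort-↭ ws)))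

-- The upper bound.

toFront : Colour → Permutation′ 3
toFront c = transpose c 0F

toFront-self : ∀ c → toFront c ⟨$⟩ʳ c ≡ 0F
toFront-self 0F = refl
toFront-self 1F = refl
toFront-self 2F = refl

MonoTriangle : Coloring n 3 → Set
MonoTriangle f = ∃[ x ] ∃[ y ] ∃[ z ]
  (x ≢ y × x ≢ z × y ≢ z) × (color f x y ≡ color f x z × color f x y ≡ color f y z)

monoTriangle? : (f : Coloring n 3) → MonoTriangle f ⊎ ¬ MonoTriangle f
monoTriangle? f = toSum (any? λ x → any? λ y → any? λ z →
  (¬? (x ≟ y) ×-dec ¬? (x ≟ z) ×-dec ¬? (y ≟ z)) ×-dec
  ((color f x y ≟ color f x z) ×-dec (color f x y ≟ color f y z)))

relabelled-triangle : (f : Coloring n 3) (π : Permutation′ 3) {σ : Fin m → Fin n} → Injective _≡_ _≡_ σ →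
  MonoTriangle (recolour π (reindex σ f)) → MonoTriangle f
relabelled-triangle f π {σ} σ-inj (x , y , z , (x≢y , x≢z , y≢z) , xy≡xz , xy≡yz) =
  σ x , σ y , σ z , (x≢y ∘ σ-inj , x≢z ∘ σ-inj , y≢z ∘ σ-inj) , perm-injective π xy≡xz , perm-injective π xy≡yz

monoRule₁-lawful : (f : Coloring n 3) → ¬ MonoTriangle f →
  ∀ {x y} → x ≢ y → Obeys f x y (monoRule 1 (color f x y))
monoRule₁-lawful f no-triangle {x} {y} x≢y = none f (mono (color f x y)) λ {z} x≢z y≢z same →
  let xy≡xz , xy≡yz = ∧⁻ {color f x y == color f x z} same
  in no-triangle (x , y , z , (x≢y , x≢z , y≢z) , ==⇒≡ xy≡xz , ==⇒≡ xy≡yz)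

-- The search only contradicts the absence of a book. As `Book` is decidable, this yields a book,
-- which is carried back through the recolouring and the renumbering.
contains-relabelled : (f : Coloring n 3) (π : Permutation′ 3) {σ : Fin m → Fin n} → Injective _≡_ _≡_ σ →
  ¬ ¬ Book (recolour π (reindex σ f)) → ContainsWithin 2 (book 5) f
contains-relabelled f π {σ} σ-inj ¬¬b with book? (recolour π (reindex σ f))
... | yes b = reindex-contains f 2 (book 5) σ-inj (book⇒contains (reindex σ f) (recolour-book π (reindex σ f) b))
... | no ¬b = contradiction ¬b ¬¬b

relabelled-gallai : (f : Coloring n 3) (π : Permutation′ 3) {σ : Fin m → Fin n} → Injective _≡_ _≡_ σ →
  Gallai f → Gallai (recolour π (reindex σ f))
relabelled-gallai f π σ-inj gallai = recolour-gallai π (reindex _ f) (reindex-gallai f σ-inj gallai)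

contains-with-triangle : (f : Coloring 9 3) → Gallai f → MonoTriangle f → ContainsWithin 2 (book 5) f
contains-with-triangle f gallai (x , y , z , (x≢y , x≢z , y≢z) , xy≡xz , xy≡yz) =
  contains-relabelled f π vertex-injective λ no-book →
    WithTriangle.Refuted-sound f′ (λ d → rainbowRule-lawful f′ gallai′ d ∷ [])
      (λ d → monoRule₂-lawful f′ gallai′ no-book d ∷ bookRules-lawful f′ no-book d)
      ordered agrees triangle-refuted
  where
  π = toFront (color f x y)
  -- `x`, `y`, `z` become `0F`, `1F`, `2F`, so `z ∷ y ∷ x ∷ []` turns into the head list of
  -- `WithTriangle`. Keys use the recoloured `f` because permuting colours can change their order.
  open Arrangement (arrange (key (recolour π f) (z ∷ y ∷ x ∷ [])) {x ∷ y ∷ z ∷ []}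
    ((x≢y ∷ x≢z ∷ []) ∷ (y≢z ∷ []) ∷ [] ∷ []))
  f′ = recolour π (reindex vertex f)
  gallai′ = relabelled-gallai f π vertex-injective gallai
  ordered : WithTriangle.Ordered f′
  ordered {1F} (s≤s ()) _
  ordered {2F} (s≤s (s≤s ())) _
  ordered {suc (suc (suc i))} {suc (suc (suc j))} _ (s≤s (s≤s (s≤s i≤j))) = cast-sorted _ i≤j
  front : ∀ {c} → color f x y ≡ c → π ⟨$⟩ʳ c ≡ 0F
  front refl = toFront-self (color f x y)
  agrees : Agrees f′ triangleTable
  agrees =
    set-agrees f′ 0F 2F (set-agrees f′ 1F 2F (set-agrees f′ 0F 1F (empty-agrees f′)
      (λ ()) (front refl)) (λ ()) (front xy≡yz)) (λ ()) (front xy≡xz)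

contains-without-triangle : (f : Coloring 9 3) → Gallai f → ¬ MonoTriangle f → ContainsWithin 2 (book 5) f
contains-without-triangle f gallai no-triangle =
  contains-relabelled f π vertex-injective λ no-book →
    WithoutTriangle.Refuted-sound f′ (λ d → rainbowRule-lawful f′ gallai′ d ∷ monoRule₁-lawful f′ no-triangle′ d ∷ [])
      (bookRules-lawful f′ no-book)
      ordered agrees edge-refuted
  where
  π = toFront (color f 0F 1F)
  open Arrangement (arrange (key (recolour π f) (1F ∷ 0F ∷ [])) {0F ∷ 1F ∷ []}
    (((λ ()) ∷ []) ∷ [] ∷ []))
  f′ = recolour π (reindex vertex f)
  gallai′ = relabelled-gallai f π vertex-injective gallai
  no-triangle′ = no-triangle ∘ relabelled-triangle f π vertex-injective
  ordered : WithoutTriangle.Ordered f′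
  ordered {1F} (s≤s ()) _
  ordered {suc (suc i)} {suc (suc j)} _ (s≤s (s≤s i≤j)) = cast-sorted _ i≤j
  agrees : Agrees f′ edgeTable
  agrees = set-agrees f′ 0F 1F (empty-agrees f′) (λ ()) (toFront-self (color f 0F 1F))

every-nine : GallaiRamseyProperty 3 2 (book 5) 9
every-nine f gallai =
  [ contains-with-triangle f gallai , contains-without-triangle f gallai ]′ (monoTriangle? f)

-- The lower bound.

-- Four pairs, joined inside by colour 0; the pairs at distance 1 on the path
-- 0 - 1 - 2 - 3 are joined by colour 1, and the complementary path 2 - 0 - 3 - 1
-- carries colour 2.
extremal : Coloring 8 3
extremal = record
  { color     = λ x y → level ∣ toℕ x / 2 - toℕ y / 2 ∣
  ; color-sym = λ x y → cong level (∣-∣-comm (toℕ x / 2) (toℕ y / 2))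
  }
  where
  level : ℕ → Colour
  level 0             = 0F
  level 1             = 1F
  level (suc (suc _)) = 2F

-- Two vertices of one pair see any third vertex in equal colours, and vertices from three pairs
-- span only colours `1F` and `2F`. The proof enumerates all triples.
extremal-gallai : Gallai extremal
extremal-gallai = from-no (any? λ x → any? λ y → any? λ z →
  (¬? (x ≟ y) ×-dec ¬? (x ≟ z) ×-dec ¬? (y ≟ z)) ×-dec
  ¬? (c x y ≟ c x z) ×-dec ¬? (c x y ≟ c y z) ×-dec ¬? (c x z ≟ c y z))
  where
  c = color extremal

Touches : Coloring n 3 → Fin n → Fin n → Colour → Fin n → Set
Touches f x y d p = x ≢ p × y ≢ p × (color f x p ≡ d ⊎ color f y p ≡ d)

-- Among eight vertices six lie off an edge, and losing two to colour `d` leaves only four pages.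
-- Explicit witnesses make this decidable without ranging over embeddings of the book.
TwiceTouched : Coloring n 3 → Set
TwiceTouched f = ∀ x y d → x ≡ y ⊎ color f x y ≡ d ⊎
  (∃[ p ] ∃[ q ] p ≢ q × Touches f x y d p × Touches f x y d q)

missing : (S : Subset 3) → ∣ S ∣ ≤ 2 → ∃[ d ] d ∉ S
missing (outside ∷ _)                      _ = 0F , λ ()
missing (inside ∷ outside ∷ _)             _ = 1F , λ { (Vec.there ()) }
missing (inside ∷ inside ∷ outside ∷ [])   _ = 2F , λ { (Vec.there (Vec.there ())) }
missing (inside ∷ inside ∷ inside ∷ [])    (s≤s (s≤s ()))

splitAt-injective : ∀ m n → Injective _≡_ _≡_ (splitAt m {n})
splitAt-injective m n = Injection.injective (↔⇒↣ (+↔⊎ {m} {n}))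

map₂-injective : ∀ {A B C : Set} {g : B → C} → Injective _≡_ _≡_ g → Injective _≡_ _≡_ (Sum.map₂ {A = A} g)
map₂-injective g-inj {inj₁ _} {inj₁ _} refl = refl
map₂-injective g-inj {inj₂ _} {inj₂ _} eq   = cong inj₂ (g-inj (inj₂-injective eq))

-- The seven vertices of a book and the two vertices touched by the omitted colour would be nine
-- distinct vertices among eight.
touched⇒bookless : (f : Coloring 8 3) → TwiceTouched f → ¬ ContainsWithin 2 (book 5) f
touched⇒bookless f touched (φ , φ-inj , S , ∣S∣≤2 , within) with d , d∉S ← missing S ∣S∣≤2
  with touched (φ (inj₁ 0F)) (φ (inj₁ 1F)) d
... | inj₁ x≡y with () ← φ-inj x≡y
... | inj₂ (inj₁ xy≡d) = d∉S (subst (_∈ S) xy≡d (within (inj₁ 0F) (inj₁ 1F) λ ()))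
... | inj₂ (inj₂ (p , q , p≢q , p-touches , q-touches)) =
  -- `Fin 9` is split as 2 + (2 + 5): touched vertices, spine, pages.
  <⇒≱ {8} {9} ≤-refl (injective⇒≤ {f = λ i → ψ (Sum.map₂ (splitAt 2) (splitAt 2 i))} (λ eq →
    splitAt-injective 2 7 (map₂-injective (splitAt-injective 2 5) (ψ-inj _ _ eq))))
  where
  avoided : ∀ {r} → Touches f (φ (inj₁ 0F)) (φ (inj₁ 1F)) d r → ∀ u → φ u ≢ r
  avoided (x≢r , y≢r , xr≡d) (inj₁ 0F) = x≢r
  avoided (x≢r , y≢r , xr≡d) (inj₁ 1F) = y≢r
  avoided (x≢r , y≢r , xr≡d) (inj₂ i) refl =
    d∉S ([ (λ e → subst (_∈ S) e (within (inj₁ 0F) (inj₂ i) tt))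
         , (λ e → subst (_∈ S) e (within (inj₁ 1F) (inj₂ i) tt)) ] xr≡d)
  ψ : Fin 2 ⊎ (Fin 2 ⊎ Fin 5) → Fin 8
  ψ (inj₁ 0F) = p
  ψ (inj₁ 1F) = q
  ψ (inj₂ u)  = φ u
  ψ-inj : ∀ u v → ψ u ≡ ψ v → u ≡ v
  ψ-inj (inj₁ 0F) (inj₁ 0F) _  = refl
  ψ-inj (inj₁ 0F) (inj₁ 1F) eq = contradiction eq p≢q
  ψ-inj (inj₁ 1F) (inj₁ 0F) eq = contradiction (sym eq) p≢q
  ψ-inj (inj₁ 1F) (inj₁ 1F) _  = refl
  ψ-inj (inj₁ 0F) (inj₂ u)  eq = contradiction (sym eq) (avoided p-touches u)
  ψ-inj (inj₁ 1F) (inj₂ u)  eq = contradiction (sym eq) (avoided q-touches u)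
  ψ-inj (inj₂ u)  (inj₁ 0F) eq = contradiction eq (avoided p-touches u)
  ψ-inj (inj₂ u)  (inj₁ 1F) eq = contradiction eq (avoided q-touches u)
  ψ-inj (inj₂ u)  (inj₂ v)  eq = cong inj₂ (φ-inj eq)

-- For `d = 0F` the partners of `x` and `y` serve. For another `d`, the pair of `x` is joined in
-- colour `d` to some other pair, which cannot contain `y`; its two vertices serve. The check itself
-- is by enumeration.
extremal-touched : TwiceTouched extremal
extremal-touched = from-yes (all? λ x → all? λ y → all? λ d →
  (x ≟ y) ⊎-dec (c x y ≟ d) ⊎-dec
  (any? λ p → any? λ q → ¬? (p ≟ q) ×-dec touches? x y d p ×-dec touches? x y d q))
  where
  c = color extremal
  touches? : ∀ x y d p → Dec (Touches extremal x y d p)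
  touches? x y d p = ¬? (x ≟ p) ×-dec ¬? (y ≟ p) ×-dec ((c x p ≟ d) ⊎-dec (c y p ≟ d))

-- Restricting `extremal` to `n` vertices treats all smaller orders at once, since a book in the
-- restriction is a book in `extremal`.
at-least-nine : n ≤ 8 → ¬ GallaiRamseyProperty 3 2 (book 5) n
at-least-nine {n} n≤8 every-n = touched⇒bookless extremal extremal-touched
  (reindex-contains extremal 2 (book 5) σ-inj
    (every-n (reindex σ extremal) (reindex-gallai extremal σ-inj extremal-gallai)))
  where
  σ : Fin n → Fin 8
  σ i = inject≤ i n≤8
  σ-inj : Injective _≡_ _≡_ σ
  σ-inj = inject≤-injective n≤8 n≤8 _ _

theorem4p1 : gr[ 3 , 2 ] (book 5) ≔ 9
theorem4p1 = every-nine , λ q every-q → ≰⇒> λ q≤8 → at-least-nine q≤8 every-q
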